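{- Let $G$ be a finite simple graph that is $(P_3\cup P_2,K_4)$-free. If $G$ contains an induced subgraph isomorphic to the co-domino or to the co-A, then $\chi(G)\le 7$.
   Context: $P_n$ is the path on $n$ vertices, $K_4$ the complete graph on $4$ vertices, $\cup$ disjoint union; "free"/"contains" refer to induced subgraphs; $\chi$ is the chromatic number. Let $C=u_1v_1v_2v_3u_3u_2$ be a $6$-cycle (edges $u_1v_1, v_1v_2, v_2v_3, v_3u_3, u_3u_2, u_2u_1$). The co-domino is the graph obtained from $C$ by adding the edges $v_1v_3$ and $u_1u_3$. The co-A is the graph obtained from $C$ by adding the edges $v_1v_3$, $u_1u_3$ and $u_1v_3$. -}

module Defs where

open import Data.Fin using (Fin; suc; toℕ; splitAt; finToFun; funToFin; _≟_)
open import Data.Fin.Patterns using (0F; 1F; 2F; 3F; 4F; 5F)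
open import Data.Fin.Properties using (any?; all?; finToFun-funToFin)
open import Data.List using (List; []; _∷_; _++_)
open import Data.List.Membership.Propositional using (_∈_)
open import Data.List.Relation.Unary.All as All using (All)
open import Data.Nat as ℕ using (ℕ; zero; suc; _+_; _≤_; z≤n; s≤s)
open import Data.Nat.Properties using (1+n≢n)
open import Data.Product using (Σ-syntax; ∃; _×_; _,_; proj₁; proj₂)
open import Data.Product.Properties using (≡-dec)
open import Data.Sum using (_⊎_; inj₁; inj₂; [_,_]; swap)
open import Data.Sum.Relation.Binary.Pointwise
  using (Pointwise; ⊎-symmetric; ⊎-decidable; inj₁; inj₂)
open import Function using (_∘_; _on_; _⇔_)
open import Function.Definitions using (Injective)
open import Level using (0ℓ)
open import Relation.Binary using (Rel; Symmetric; Irreflexive; Decidable)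
open import Relation.Binary.PropositionalEquality
  using (_≡_; _≢_; refl; sym; trans; ≢-sym)
open import Relation.Nullary using (¬_; Dec; yes; no; ¬?; contradiction)
open import Relation.Nullary.Decidable
  using (map′; True; toWitness; _⊎-dec_; _→-dec_)
import Data.List.Membership.DecPropositional as DecMembership
import Relation.Unary as U

-- Decidability of adjacency is automatic classically and is part of what it
-- means, constructively, for a graph to be given as a finite object.
record Graph (n : ℕ) : Set₁ where
  infix 4 _~_ _~?_
  field
    _~_    : Rel (Fin n) 0ℓ
    ~-sym  : Symmetric _~_
    ~-irr  : Irreflexive _≡_ _~_
    _~?_   : Decidable _~_

open Graph public using () renaming (_~_ to Adj)

Path : ∀ n → Graph n
Path n = record
  { _~_   = λ i j → suc (toℕ i) ≡ toℕ j ⊎ suc (toℕ j) ≡ toℕ i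
  ; ~-sym = swap
  ; ~-irr = λ { refl → [ 1+n≢n , 1+n≢n ] }
  ; _~?_  = λ i j → (suc (toℕ i) ℕ.≟ toℕ j) ⊎-dec (suc (toℕ j) ℕ.≟ toℕ i)
  }

Complete : ∀ n → Graph n
Complete n = record
  { _~_   = _≢_
  ; ~-sym = ≢-sym
  ; ~-irr = λ i≡j i≢j → i≢j i≡j
  ; _~?_  = λ i j → ¬? (i ≟ j)
  }

-- Disjoint union: the first m vertices carry G, the last n carry H.
infixr 6 _∪_
_∪_ : ∀ {m n} → Graph m → Graph n → Graph (m + n)
_∪_ {m} G H = record
  { _~_   = Pointwise G._~_ H._~_ on splitAt m
  ; ~-sym = ⊎-symmetric G.~-sym H.~-sym
  ; ~-irr = λ { {i} refl → irr (splitAt m i) }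
  ; _~?_  = λ i j → ⊎-decidable G._~?_ H._~?_ (splitAt m i) (splitAt m j)
  }
  where
  module G = Graph G
  module H = Graph H
  irr : ∀ x → ¬ Pointwise G._~_ H._~_ x x
  irr _ (inj₁ e) = G.~-irr refl e
  irr _ (inj₂ e) = H.~-irr refl e

EdgeList : ℕ → Set
EdgeList n = List (Fin n × Fin n)

-- Each pair in the list is read as an unordered edge.
fromEdges : ∀ {n} (E : EdgeList n) →
            {True (All.all? (λ e → ¬? (proj₁ e ≟ proj₂ e)) E)} → Graph n
fromEdges E {loopless} = record
  { _~_   = λ u v → (u , v) ∈ E ⊎ (v , u) ∈ E
  ; ~-sym = swap
  ; ~-irr = λ { refl → [ irr , irr ] }
  ; _~?_  = λ u v → ((u , v) ∈? E) ⊎-dec ((v , u) ∈? E)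
  }
  where
  open DecMembership (≡-dec _≟_ _≟_) using (_∈?_)
  irr : ∀ {u} → ¬ ((u , u) ∈ E)
  irr u∈E = All.lookup (toWitness loopless) u∈E refl

pattern u₁ = 0F
pattern v₁ = 1F
pattern v₂ = 2F
pattern v₃ = 3F
pattern u₃ = 4F
pattern u₂ = 5F

C : EdgeList 6
C = (u₁ , v₁) ∷ (v₁ , v₂) ∷ (v₂ , v₃) ∷ (v₃ , u₃) ∷ (u₃ , u₂) ∷ (u₂ , u₁) ∷ []

co-domino : Graph 6
co-domino = fromEdges (C ++ (v₁ , v₃) ∷ (u₁ , u₃) ∷ [])

co-A : Graph 6
co-A = fromEdges (C ++ (v₁ , v₃) ∷ (u₁ , u₃) ∷ (u₁ , v₃) ∷ [])

infix 4 _Contains_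
_Contains_ : ∀ {m n} → Graph n → Graph m → Set
_Contains_ {m} {n} G H =
  Σ[ f ∈ (Fin m → Fin n) ]
    Injective _≡_ _≡_ f × (∀ i j → Adj H i j ⇔ Adj G (f i) (f j))

infix 4 _IsFreeOf_
_IsFreeOf_ : ∀ {m n} → Graph n → Graph m → Set
G IsFreeOf H = ¬ (G Contains H)

IsProper : ∀ {n k} → Graph n → (Fin n → Fin k) → Set
IsProper G c = ∀ u v → Adj G u v → c u ≢ c v

Colourable : ∀ {n} → Graph n → ℕ → Set
Colourable {n} G k = Σ[ c ∈ (Fin n → Fin k) ] IsProper G c

-- There are k ^ n maps Fin n → Fin k, enumerated by finToFun.
colourable? : ∀ {n} (G : Graph n) → U.Decidable (Colourable G)
colourable? {n} G k = map′ to from (any? (λ i → proper? (finToFun {k} {n} i)))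
  where
  open Graph G using (_~?_)
  proper? : (c : Fin n → Fin k) → Dec (IsProper G c)
  proper? c = all? λ u → all? λ v → (u ~? v) →-dec ¬? (c u ≟ c v)
  to : (∃ λ i → IsProper G (finToFun {k} {n} i)) → Colourable G k
  to (i , p) = finToFun i , p
  from : Colourable G k → ∃ λ i → IsProper G (finToFun {k} {n} i)
  from (c , p) = funToFin c , λ u v e eq →
    p u v e (trans (sym (finToFun-funToFin c u)) (trans eq (finToFun-funToFin c v)))

colourable-n : ∀ {n} (G : Graph n) → Colourable G n
colourable-n G = (λ u → u) , λ u v e u≡v → Graph.~-irr G u≡v e

IsLeast : (ℕ → Set) → ℕ → Set
IsLeast P k = P k × (∀ j → P j → k ≤ j)

least : ∀ {P : ℕ → Set} → U.Decidable P → ∀ n → P n → ∃ (IsLeast P)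
least P? zero    p = zero , p , λ _ _ → z≤n
least {P} P? (suc n) p with P? zero
... | yes p₀ = zero , p₀ , λ _ _ → z≤n
... | no ¬p₀ with least (P? ∘ suc) n p
...   | k , pₖ , min = suc k , pₖ , λ where
        zero    p₀ → contradiction p₀ ¬p₀
        (suc j) pⱼ → s≤s (min j pⱼ)

chromatic : ∀ {n} (G : Graph n) → ∃ (IsLeast (Colourable G))
chromatic {n} G = least (colourable? G) n (colourable-n G)

χ : ∀ {n} → Graph n → ℕ
χ G = proj₁ (chromatic G)

{-# OPTIONS --safe #-}

-- Fix an induced co-domino or co-A on six vertices. Every other vertex x has a
-- row, its set of neighbours among the six; freeness excludes many rows, and
-- many pairs of rows for adjacent vertices. Suppose χ(G) > 7. If adjoining a
-- vertex of row r to the six makes all rows over the seven vertices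
-- 7-colourable, then no vertex has row r; if the same holds for two adjacent
-- vertices of rows r and s, then no such edge exists. In either
-- case fourteen deductions of this kind leave rows that are 7-colourable
-- themselves. Here a row that still admits edges spans a matching, and is given
-- two colours. The colourings were found by computer search; they are checked
-- by evaluating a decision procedure.
module Submission where

open import Data.Bool using (Bool; true; false; if_then_else_)
import Data.Bool.Properties as Bool
open import Data.Fin using (Fin; zero; suc; _<_; _≟_)
open import Data.Fin.Patterns using (0F; 1F; 2F; 3F)
open import Data.Fin.Properties using (any?; all?; _<?_; <-cmp; <⇒≢; <-trans)
open import Data.List using (List; []; _∷_; _++_; map; filter; concatMap; allFin)
import Data.List as List
import Data.List.Membership.DecPropositional as DecMembership
open import Data.List.Membership.Propositional using (_∈_; lose)
open import Data.List.Membership.Propositional.Properties using (∈-filter⁺; ∈-concatMap⁺)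
open import Data.List.Relation.Unary.All as All using (All; []; _∷_)
import Data.List.Relation.Unary.All.Properties as All
open import Data.List.Relation.Unary.Any as Any using (Any; here; there)
open import Data.Nat using (ℕ; zero; suc; _≤_)
open import Data.Nat.DivMod using (_/_; _mod_)
open import Data.Nat.GeneralisedArithmetic using (fold)
open import Data.Product using (∃; _×_; _,_; proj₁; proj₂; map₁)
open import Data.Sum using (_⊎_; inj₁; inj₂)
open import Data.Vec using (Vec; []; _∷_; lookup; tabulate)
open import Data.Vec.Functional using () renaming (_∷_ to _◂_; [] to ∅)
import Data.Vec.Properties as Vec
open import Function using (_∘_; mk⇔)
open import Function.Definitions using (Injective)
open import Relation.Binary.Definitions using (tri<; tri≈; tri>)
open import Relation.Binary.PropositionalEquality
  using (_≡_; _≢_; refl; sym; trans; cong; cong₂; subst)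
open import Relation.Nullary using (¬_; Dec; yes; no; does; ¬?; contradiction)
open import Relation.Nullary.Decidable
  using (True; toWitness; dec-true; dec-false; does-⇔; decidable-stable;
         _×-dec_; _⊎-dec_; _→-dec_)
open import Defs

-- Graphs as adjacency tables.

-- A graph on Fin n is stored as its strictly triangular adjacency table, so
-- that adjoining a vertex is a constructor; the new vertex gets index zero.
Row : ℕ → Set
Row = Vec Bool

infixr 5 _▷_
data Shape : ℕ → Set where
  []  : Shape 0
  _▷_ : ∀ {n} → Row n → Shape n → Shape (suc n)

edge : ∀ {n} → Shape n → Fin n → Fin n → Bool
edge (r ▷ K) zero    zero    = false
edge (r ▷ K) zero    (suc j) = lookup r j
edge (r ▷ K) (suc i) zero    = lookup r i
edge (r ▷ K) (suc i) (suc j) = edge K i j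

shape : ∀ {n} → (Fin n → Fin n → Bool) → Shape n
shape {zero}  h = []
shape {suc n} h = tabulate (h zero ∘ suc) ▷ shape (λ i j → h (suc i) (suc j))

-- `shape` reads `h` only above the diagonal, so irreflexivity and symmetry must supply the
-- remaining entries.
edge-shape : ∀ {n} (h : Fin n → Fin n → Bool) →
  (∀ i → h i i ≡ false) → (∀ i j → h i j ≡ h j i) →
  ∀ i j → edge (shape h) i j ≡ h i j
edge-shape h irr sm zero    zero    = sym (irr zero)
edge-shape h irr sm zero    (suc j) = Vec.lookup∘tabulate (h zero ∘ suc) j
edge-shape h irr sm (suc i) zero    =
  trans (Vec.lookup∘tabulate (h zero ∘ suc) i) (sm zero (suc i))
edge-shape h irr sm (suc i) (suc j) =
  edge-shape (λ i j → h (suc i) (suc j)) (irr ∘ suc) (λ i j → sm (suc i) (suc j)) i j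

adjacent : ∀ {n} → Graph n → Fin n → Fin n → Bool
adjacent H i j = does (Graph._~?_ H i j)

shapeOf : ∀ {n} → Graph n → Shape n
shapeOf H = shape (adjacent H)

edge-shapeOf : ∀ {n} (H : Graph n) i j → edge (shapeOf H) i j ≡ adjacent H i j
edge-shapeOf H = edge-shape (adjacent H)
  (λ i → dec-false (i ~? i) (~-irr refl))
  (λ i j → does-⇔ (mk⇔ ~-sym ~-sym) (i ~? j) (j ~? i))
  where open Graph H

-- Partial rows and the enumeration of rows.

-- A cube is a partial row, prescribing some of the adjacencies.
Literal Cube : ℕ → Set
Literal n = Fin n × Bool
Cube n    = List (Literal n)

pattern _⁺ i = i , true
pattern _⁻ i = i , false

_⊨_ : ∀ {n} → Row n → Literal n → Set
r ⊨ (i , b) = lookup r i ≡ b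

Matches : ∀ {n} → Row n → Cube n → Set
Matches r c = All (r ⊨_) c

matches? : ∀ {n} (r : Row n) c → Dec (Matches r c)
matches? r = All.all? λ (i , b) → lookup r i Bool.≟ b

-- Turns a full row into a cube, so that `separate` can store it among the blocks.
exactly : ∀ {n} → Row n → Cube n
exactly r = List.tabulate λ i → i , lookup r i

exactly⇒≡ : ∀ {n} {r s : Row n} → Matches r (exactly s) → r ≡ s
exactly⇒≡ {r = r} {s} m =
  trans (sym (Vec.tabulate∘lookup r))
    (trans (Vec.tabulate-cong (All.tabulate⁻ m)) (Vec.tabulate∘lookup s))

weaken : ∀ {n} → Cube n → Cube (suc n)
weaken = map (map₁ suc)

_≟ʳ_ : ∀ {n} (r s : Row n) → Dec (r ≡ s)
_≟ʳ_ = Vec.≡-dec Bool._≟_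

allRows : ∀ n → List (Row n)
allRows zero    = [] ∷ []
allRows (suc n) = concatMap (λ r → (false ∷ r) ∷ (true ∷ r) ∷ []) (allRows n)

∈-allRows : ∀ {n} (r : Row n) → r ∈ allRows n
∈-allRows []          = here refl
∈-allRows (false ∷ r) = ∈-concatMap⁺ _ (lose (∈-allRows r) (here refl))
∈-allRows (true ∷ r)  = ∈-concatMap⁺ _ (lose (∈-allRows r) (there (here refl)))

-- Lists of cubes are built with `each` and `when`, so that `All-each` and `All-when` let a
-- soundness proof follow the same nesting and recover the tested conditions.
each : ∀ {n} {B : Set} → (Fin n → List B) → List B
each g = concatMap g (allFin _)

when : ∀ {A B : Set} → Dec A → List B → List B
when d xs = if does d then xs else []

All-concatMap : ∀ {A B : Set} {P : B → Set} {g : A → List B} →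
  (∀ a → All P (g a)) → ∀ as → All P (concatMap g as)
All-concatMap p []       = []
All-concatMap p (a ∷ as) = All.++⁺ (p a) (All-concatMap p as)

All-each : ∀ {n} {B : Set} {P : B → Set} {g : Fin n → List B} →
  (∀ i → All P (g i)) → All P (each g)
All-each p = All-concatMap p (allFin _)

All-when : ∀ {A B : Set} {P : B → Set} {xs : List B} (d : Dec A) →
  (A → All P xs) → All P (when d xs)
All-when (yes a) p = p a
All-when (no _)  p = []

∈-when : ∀ {A B : Set} {x : B} {xs : List B} (d : Dec A) →
  A → x ∈ xs → x ∈ when d xs
∈-when (yes _) a x∈ = x∈
∈-when (no ¬a) a x∈ = contradiction a ¬a

-- Rows and pairs of rows forbidden by freeness.

module _ {n} (K : Shape n) where

  Edge Nonedge : Fin n → Fin n → Set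
  Edge    i j = edge K i j ≡ true
  Nonedge i j = edge K i j ≡ false

  edge? : ∀ i j → Dec (Edge i j)
  edge? i j = edge K i j Bool.≟ true

  nonedge? : ∀ i j → Dec (Nonedge i j)
  nonedge? i j = edge K i j Bool.≟ false

  far? : ∀ i j k → Dec (Nonedge i k × Nonedge j k)
  far? i j k = nonedge? i k ×-dec nonedge? j k

  eachEdge : {B : Set} → (Fin n → Fin n → List B) → List B
  eachEdge g = each λ i → each λ j → when (i <? j ×-dec edge? i j) (g i j)

  eachPath : {B : Set} → (Fin n → Fin n → Fin n → List B) → List B
  eachPath g = each λ i → each λ j → when (edge? i j) (
    -- `i < k` lists each path in one direction only, and makes its ends distinct.
    each λ k → when (i <? k ×-dec edge? j k ×-dec nonedge? i k) (g i j k))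

  -- The rows excluded for a further vertex x, according to the role of x: in
  -- K₄; at an end and at the middle of P₃, disjoint from the edge ij; in P₂.
  vertexCubes : List (Cube n)
  vertexCubes =
    eachEdge (λ i j →
      each (λ k → when (j <? k ×-dec edge? i k ×-dec edge? j k)
        ((i ⁺ ∷ j ⁺ ∷ k ⁺ ∷ []) ∷ []))
      ++ each (λ k → when (far? i j k) (each λ l → when (far? i j l) (
        when (edge? k l) ((k ⁺ ∷ l ⁻ ∷ i ⁻ ∷ j ⁻ ∷ []) ∷ [])
        ++ when (k <? l ×-dec nonedge? k l) ((k ⁺ ∷ l ⁺ ∷ i ⁻ ∷ j ⁻ ∷ []) ∷ [])))))
    ++ eachPath (λ i j k → each λ l → when (far? i j l ×-dec nonedge? k l)
      ((l ⁺ ∷ i ⁻ ∷ j ⁻ ∷ k ⁻ ∷ []) ∷ []))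

  -- The pairs of rows excluded for two further adjacent vertices x and y: both
  -- in K₄; both in P₃, disjoint from the edge ij; forming P₂.
  pairCubes : List (Cube n × Cube n)
  pairCubes =
    eachEdge (λ i j → (i ⁺ ∷ j ⁺ ∷ [] , i ⁺ ∷ j ⁺ ∷ [])
      ∷ each (λ k → when (far? i j k)
        ( (k ⁺ ∷ i ⁻ ∷ j ⁻ ∷ [] , k ⁻ ∷ i ⁻ ∷ j ⁻ ∷ [])
        ∷ (k ⁻ ∷ i ⁻ ∷ j ⁻ ∷ [] , k ⁺ ∷ i ⁻ ∷ j ⁻ ∷ []) ∷ [])))
    ++ eachPath (λ i j k → (i ⁻ ∷ j ⁻ ∷ k ⁻ ∷ [] , i ⁻ ∷ j ⁻ ∷ k ⁻ ∷ []) ∷ [])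

  module _ {B : Set} {P : B → Set} where

    All-eachEdge : {g : Fin n → Fin n → List B} →
      (∀ {i j} → Edge i j → All P (g i j)) → All P (eachEdge g)
    All-eachEdge p = All-each λ i → All-each λ j →
      All-when (i <? j ×-dec edge? i j) λ (_ , ij) → p ij

    All-eachPath : {g : Fin n → Fin n → Fin n → List B} →
      (∀ {i j k} → i ≢ k → Edge i j → Edge j k → Nonedge i k → All P (g i j k)) →
      All P (eachPath g)
    All-eachPath p = All-each λ i → All-each λ j → All-when (edge? i j) λ ij →
      All-each λ k → All-when (i <? k ×-dec edge? j k ×-dec nonedge? i k)
        λ (i<k , jk , ik) → p (<⇒≢ i<k) ij jk ik

-- Theories, their colourings and certificates.

-- `rows` over-approximates the rows that vertices off the table can have. A member of `blocks`
-- forbids an edge from a vertex matching its first cube to one matching its second.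
record Theory (n : ℕ) : Set where
  constructor theory
  field
    table  : Shape n
    rows   : List (Row n)
    blocks : List (Cube n × Cube n)

open Theory

Blocks : ∀ {n} → List (Cube n × Cube n) → Row n → Row n → Set
Blocks bs r s = Any (λ (c , d) → Matches r c × Matches s d) bs

blocks? : ∀ {n} (bs : List (Cube n × Cube n)) r s → Dec (Blocks bs r s)
blocks? bs r s = Any.any? (λ (c , d) → matches? r c ×-dec matches? s d) bs

avoids? : ∀ {n} (cs : List (Cube n)) r → Dec (¬ Any (Matches r) cs)
avoids? cs r = ¬? (Any.any? (matches? r) cs)

start : ∀ {n} → Shape n → Theory n
start {n} K = theory K (filter (avoids? (vertexCubes K)) (allRows n)) (pairCubes K)

-- Cubes that do not mention the vertex just adjoined are already accounted for.
new? : ∀ {n} (c : Cube (suc n)) → Dec (Any (λ l → proj₁ l ≡ zero) c)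
new? = Any.any? λ l → proj₁ l ≟ zero

-- Each old row gains a leading bit for adjacency to the new vertex; the bit `true` is discarded
-- where `bs` forbids that edge.
extend : ∀ {n} → Theory n → Row n → Theory (suc n)
extend (theory K rs bs) r = theory (r ▷ K)
  (filter (avoids? (filter new? (vertexCubes (r ▷ K))))
    (concatMap (λ s → (false ∷ s) ∷ when (¬? (blocks? bs r s)) ((true ∷ s) ∷ [])) rs))
  (map (λ (c , d) → weaken c , weaken d) bs
    ++ filter (λ (c , d) → new? c ⊎-dec new? d) (pairCubes (r ▷ K)))

without : ∀ {n} → Theory n → Row n → Theory n
without (theory K rs bs) r = theory K (filter (λ s → ¬? (s ≟ʳ r)) rs) bs

-- Both orders are stored because `Blocks` is directed and `Proper` tests ordered pairs of entries.
separate : ∀ {n} → Theory n → Row n → Row n → Theory n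
separate (theory K rs bs) r s =
  theory K rs ((exactly r , exactly s) ∷ (exactly s , exactly r) ∷ bs)

Entry : ℕ → Set
Entry n = Row n × Fin 7 × Fin 7

-- Vertices of such a row r induce a matching: a triangle among them would form
-- K₄ with i, and an induced P₃ would form P₃ ∪ P₂ with jk.
Matching : ∀ {n} → Shape n → Row n → Set
Matching K r =
  (∃ λ i → r ⊨ (i ⁺)) × (∃ λ j → ∃ λ k → Edge K j k × r ⊨ (j ⁻) × r ⊨ (k ⁻))

matching? : ∀ {n} (K : Shape n) r → Dec (Matching K r)
matching? K r =
  any? (λ i → lookup r i Bool.≟ true) ×-dec
  any? (λ j → any? λ k →
    edge? K j k ×-dec lookup r j Bool.≟ false ×-dec lookup r k Bool.≟ false)

-- Disjoint colour pairs tolerate any edges between the two rows. On the diagonal this alternative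
-- fails, so every row must be blocked against itself or be a matching with two colours.
Compatible : ∀ {n} → Theory n → Entry n → Entry n → Set
Compatible Θ (r , a , b) (s , a′ , b′) =
  ((a ≢ a′ × a ≢ b′) × (b ≢ a′ × b ≢ b′))
  ⊎ Blocks (blocks Θ) r s
  ⊎ (r ≡ s × a ≡ a′ × b ≡ b′ × a ≢ b × Matching (table Θ) r)

_≢?_ : ∀ {n} (i j : Fin n) → Dec (i ≢ j)
i ≢? j = ¬? (i ≟ j)

compatible? : ∀ {n} (Θ : Theory n) e e′ → Dec (Compatible Θ e e′)
compatible? Θ (r , a , b) (s , a′ , b′) =
  ((a ≢? a′ ×-dec a ≢? b′) ×-dec (b ≢? a′ ×-dec b ≢? b′))
  ⊎-dec blocks? (blocks Θ) r s
  ⊎-dec (r ≟ʳ s ×-dec a ≟ a′ ×-dec b ≟ b′ ×-dec a ≢? b ×-dec matching? (table Θ) r)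

Proper : ∀ {n} → Theory n → Vec (Fin 7) n → List (Entry n) → Set
Proper Θ cs es =
  (∀ i j → Edge (table Θ) i j → lookup cs i ≢ lookup cs j)
  × All (λ (r , a , b) → ∀ i → r ⊨ (i ⁺) → lookup cs i ≢ a × lookup cs i ≢ b) es
  × All (λ e → All (Compatible Θ e) es) es

proper? : ∀ {n} (Θ : Theory n) cs es → Dec (Proper Θ cs es)
proper? Θ cs es =
  all? (λ i → all? λ j → edge? (table Θ) i j →-dec lookup cs i ≢? lookup cs j)
  ×-dec All.all? (λ (r , a , b) → all? λ i → lookup r i Bool.≟ true →-dec
    (lookup cs i ≢? a ×-dec lookup cs i ≢? b)) es
  ×-dec All.all? (λ e → All.all? (compatible? Θ e) es) es

-- Colourings are read off base 7 numerals, least significant digit first: one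
-- digit per vertex of the table, then one per row, or two if adjacent vertices
-- may share that row.
digits : ∀ n → ℕ → Vec (Fin 7) n
digits zero    d = []
digits (suc n) d = (d mod 7) ∷ digits n (d / 7)

entries : ∀ {n} → List (Cube n × Cube n) → List (Row n) → ℕ → List (Entry n)
entries bs []       d = []
entries bs (r ∷ rs) d =
  if does (blocks? bs r r)
  then (r , d mod 7 , d mod 7) ∷ entries bs rs (d / 7)
  else (r , d mod 7 , (d / 7) mod 7) ∷ entries bs rs (d / 7 / 7)

-- Whatever numeral is decoded, no row is missed, so `Proper` has only conflicts to check.
entries-complete : ∀ {n} bs {rs : List (Row n)} {r} d → r ∈ rs →
  ∃ λ p → (r , p) ∈ entries bs rs d
entries-complete bs {r ∷ rs} d r∈ with does (blocks? bs r r) | r∈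
... | true  | here refl = _ , here refl
... | false | here refl = _ , here refl
... | true  | there r∈′ with p , p∈ ← entries-complete bs (d / 7) r∈′     = p , there p∈
... | false | there r∈′ with p , p∈ ← entries-complete bs (d / 7 / 7) r∈′ = p , there p∈

Coloured : ∀ {n} → Theory n → ℕ → Set
Coloured {n} Θ d =
  -- Dividing by 7 `n` times discards the digits already spent on the table.
  Proper Θ (digits n d) (entries (blocks Θ) (rows Θ) (fold d (_/ 7) n))

coloured? : ∀ {n} (Θ : Theory n) d → Dec (Coloured Θ d)
coloured? {n} Θ d = proper? Θ (digits n d) (entries (blocks Θ) (rows Θ) (fold d (_/ 7) n))

data Step (n : ℕ) : Set where
  drop : Row n → ℕ → Step n
  cut  : Row n → Row n → ℕ → Step n

-- `r` stays among the rows while the colouring `e` is checked, since further vertices may share it;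
-- the theory is refined only for the remaining steps. In `cut` the bit `true` joins the second new
-- vertex to the first.
Certifies : ∀ {n} → Theory n → List (Step n) → ℕ → Set
Certifies Θ []               d = Coloured Θ d
Certifies Θ (drop r e ∷ ss)  d = Coloured (extend Θ r) e × Certifies (without Θ r) ss d
Certifies Θ (cut r s e ∷ ss) d =
  Coloured (extend (extend Θ r) (true ∷ s)) e × Certifies (separate Θ r s) ss d

certifies? : ∀ {n} (Θ : Theory n) ss d → Dec (Certifies Θ ss d)
certifies? Θ []               d = coloured? Θ d
certifies? Θ (drop r e ∷ ss)  d = coloured? (extend Θ r) e ×-dec certifies? (without Θ r) ss d
certifies? Θ (cut r s e ∷ ss) d =
  coloured? (extend (extend Θ r) (true ∷ s)) e ×-dec certifies? (separate Θ r s) ss d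

record Certificate {n} (H : Graph n) : Set where
  field
    steps : List (Step n)
    final : ℕ
    valid : True (certifies? (start (shapeOf H)) steps final)

-- Embeddings of tables in a graph.

module Realisation {N} (G : Graph N) where
  open Graph G

  ~⇒≢ : ∀ {x y} → x ~ y → x ≢ y
  ~⇒≢ x~y x≡y = ~-irr x≡y x~y

  adjacent⇒~ : ∀ {x y} → adjacent G x y ≡ true → x ~ y
  adjacent⇒~ {x} {y} e with yes x~y ← x ~? y = x~y

  nonadjacent⇒≁ : ∀ {x y} → adjacent G x y ≡ false → ¬ x ~ y
  nonadjacent⇒≁ {x} {y} e with no x≁y ← x ~? y = x≁y

  record Realises {n} (K : Shape n) (f : Fin n → Fin N) : Set where
    constructor realising
    field
      injective : Injective _≡_ _≡_ f
      adjacency : ∀ i j → adjacent G (f i) (f j) ≡ edge K i j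

  open Realises public

  Outside : ∀ {n} → (Fin n → Fin N) → Fin N → Set
  Outside f x = ∀ i → f i ≢ x

  row : ∀ {n} → (Fin n → Fin N) → Fin N → Row n
  row f x = tabulate λ i → adjacent G x (f i)

  -- Serves both to assemble forbidden subgraphs vertex by vertex and to extend the table of a
  -- theory by a vertex of `G`.
  adjoin : ∀ {n} {K : Shape n} {f x r} →
    Realises K f → Outside f x → row f x ≡ r → Realises (r ▷ K) (x ◂ f)
  adjoin {K = K} {f} {x} (realising inj adj) out refl = realising inj′ adj′
    where
    inj′ : Injective _≡_ _≡_ (x ◂ f)
    inj′ {zero}  {zero}  _ = refl
    inj′ {zero}  {suc j} e = contradiction (sym e) (out j)
    inj′ {suc i} {zero}  e = contradiction e (out i)
    inj′ {suc i} {suc j} e = cong suc (inj e)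
    adj′ : ∀ i j → adjacent G ((x ◂ f) i) ((x ◂ f) j) ≡ edge (row f x ▷ K) i j
    adj′ zero    zero    = dec-false (x ~? x) (~-irr refl)
    adj′ zero    (suc j) = sym (Vec.lookup∘tabulate _ j)
    adj′ (suc i) zero    = trans (does-⇔ (mk⇔ ~-sym ~-sym) (f i ~? x) (x ~? f i))
      (sym (Vec.lookup∘tabulate _ i))
    adj′ (suc i) (suc j) = adj i j

  realises⇒contains : ∀ {n} {H : Graph n} {f} → Realises (shapeOf H) f → G Contains H
  realises⇒contains {H = H} {f} (realising inj adj) = f , inj , λ i j → mk⇔
    (λ e → adjacent⇒~ (trans (same i j) (dec-true (Graph._~?_ H i j) e)))
    (λ e → toEdge i j (trans (sym (same i j)) (dec-true (f i ~? f j) e)))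
    where
    same : ∀ i j → adjacent G (f i) (f j) ≡ adjacent H i j
    same i j = trans (adj i j) (edge-shapeOf H i j)
    toEdge : ∀ i j → adjacent H i j ≡ true → Adj H i j
    toEdge i j e with yes p ← Graph._~?_ H i j = p

  contains⇒realises : ∀ {n} {H : Graph n} ((f , _) : G Contains H) → Realises (shapeOf H) f
  contains⇒realises {H = H} (f , inj , iff) = realising inj λ i j →
    sym (trans (edge-shapeOf H i j) (does-⇔ (iff i j) (Graph._~?_ H i j) (f i ~? f j)))

  realises-∅ : Realises [] ∅
  realises-∅ = realising (λ { {()} }) λ ()

-- Soundness of theories in a free graph.

module Colouring {N} (G : Graph N)
  (noP₃∪P₂ : G IsFreeOf (Path 3 ∪ Path 2)) (noK₄ : G IsFreeOf Complete 4) where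
  open Graph G
  open Realisation G

  infixr 5 _+∷_ _-∷_
  _+∷_ : ∀ {n x y} {bs cs : Row n} → x ~ y → bs ≡ cs →
    adjacent G x y ∷ bs ≡ true ∷ cs
  _+∷_ {x = x} {y} e = cong₂ _∷_ (dec-true (x ~? y) e)

  _-∷_ : ∀ {n x y} {bs cs : Row n} → ¬ x ~ y → bs ≡ cs →
    adjacent G x y ∷ bs ≡ false ∷ cs
  _-∷_ {x = x} {y} e = cong₂ _∷_ (dec-false (x ~? y) e)

  -- Vertices are adjoined from `d` back to `a`, because the newest one gets index zero.
  ¬K₄ : ∀ {a b c d} → a ~ b → a ~ c → a ~ d → b ~ c → b ~ d → ¬ c ~ d
  ¬K₄ {a} {b} {c} {d} ab ac ad bc bd cd = noK₄ (realises⇒contains {H = Complete 4}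
    (adjoin (adjoin (adjoin (adjoin {f = ∅} {x = d} realises-∅ (λ ()) refl)
      (λ { 0F → ~⇒≢ (~-sym cd) })
      (cd +∷ refl))
      (λ { 0F → ~⇒≢ (~-sym bc) ; 1F → ~⇒≢ (~-sym bd) })
      (bc +∷ bd +∷ refl))
      (λ { 0F → ~⇒≢ (~-sym ab) ; 1F → ~⇒≢ (~-sym ac) ; 2F → ~⇒≢ (~-sym ad) })
      (ab +∷ ac +∷ ad +∷ refl)))

  -- Only `a ≢ c` needs assuming: adjacency separates the other pairs within a component, and a path
  -- vertex equal to `d` or `e` would be adjacent to the other of the two.
  ¬P₃∪P₂ : ∀ {a b c d e} → a ≢ c → a ~ b → b ~ c → ¬ a ~ c → d ~ e →
    ¬ a ~ d → ¬ a ~ e → ¬ b ~ d → ¬ b ~ e → ¬ c ~ d → ¬ ¬ c ~ e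
  ¬P₃∪P₂ {a} {b} {c} {d} {e} a≢c ab bc ac de ad ae bd be cd ce =
    noP₃∪P₂ (realises⇒contains {H = Path 3 ∪ Path 2}
      (adjoin (adjoin (adjoin (adjoin (adjoin {f = ∅} {x = e} realises-∅ (λ ()) refl)
        (λ { 0F → ~⇒≢ (~-sym de) })
        (de +∷ refl))
        (λ { 0F → λ { refl → ce de } ; 1F → λ { refl → cd (~-sym de) } })
        (cd -∷ ce -∷ refl))
        (λ { 0F → ~⇒≢ (~-sym bc) ; 1F → λ { refl → be de } ; 2F → λ { refl → bd (~-sym de) } })
        (bc +∷ bd -∷ be -∷ refl))
        (λ { 0F → ~⇒≢ (~-sym ab) ; 1F → a≢c ∘ sym
           ; 2F → λ { refl → ae de } ; 3F → λ { refl → ad (~-sym de) } })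
        (ab +∷ ac -∷ ad -∷ ae -∷ refl)))

  module _ {n} {K : Shape n} {f : Fin n → Fin N} (real : Realises K f) where

    edge⇒~ : ∀ {i j} → Edge K i j → f i ~ f j
    edge⇒~ {i} {j} e = adjacent⇒~ (trans (adjacency real i j) e)

    nonedge⇒≁ : ∀ {i j} → Nonedge K i j → ¬ f i ~ f j
    nonedge⇒≁ {i} {j} e = nonadjacent⇒≁ (trans (adjacency real i j) e)

    ⁺⇒~ : ∀ {x i} → row f x ⊨ (i ⁺) → x ~ f i
    ⁺⇒~ {i = i} e = adjacent⇒~ (trans (sym (Vec.lookup∘tabulate _ i)) e)

    ⁻⇒≁ : ∀ {x i} → row f x ⊨ (i ⁻) → ¬ x ~ f i
    ⁻⇒≁ {i = i} e = nonadjacent⇒≁ (trans (sym (Vec.lookup∘tabulate _ i)) e)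

    -- The three uses of `¬P₃∪P₂` have path `x k l` with edge `i j`, path `k x l` with edge `i j`,
    -- and path `i j k` with edge `x l`.
    vertexCubes-sound :
      All (λ c → ∀ {x} → Outside f x → ¬ Matches (row f x) c) (vertexCubes K)
    vertexCubes-sound = All.++⁺
      (All-eachEdge K λ {i} {j} ij → All.++⁺
        (All-each λ k → All-when (j <? k ×-dec edge? K i k ×-dec edge? K j k)
          λ (_ , ik , jk) →
            (λ { _ (xi ∷ xj ∷ xk ∷ []) →
              ¬K₄ (⁺⇒~ xi) (⁺⇒~ xj) (⁺⇒~ xk) (edge⇒~ ij) (edge⇒~ ik) (edge⇒~ jk) })
            ∷ [])
        (All-each λ k → All-when (far? K i j k) λ (ik , jk) →
         All-each λ l → All-when (far? K i j l) λ (il , jl) → All.++⁺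
          (All-when (edge? K k l) λ kl →
            (λ { out (xk ∷ xl ∷ xi ∷ xj ∷ []) →
              ¬P₃∪P₂ (out l ∘ sym) (⁺⇒~ xk) (edge⇒~ kl) (⁻⇒≁ xl) (edge⇒~ ij)
                (⁻⇒≁ xi) (⁻⇒≁ xj) (nonedge⇒≁ ik ∘ ~-sym) (nonedge⇒≁ jk ∘ ~-sym)
                (nonedge⇒≁ il ∘ ~-sym) (nonedge⇒≁ jl ∘ ~-sym) })
            ∷ [])
          (All-when (k <? l ×-dec nonedge? K k l) λ (k<l , kl) →
            (λ { out (xk ∷ xl ∷ xi ∷ xj ∷ []) →
              ¬P₃∪P₂ (<⇒≢ k<l ∘ injective real) (~-sym (⁺⇒~ xk)) (⁺⇒~ xl) (nonedge⇒≁ kl)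
                (edge⇒~ ij) (nonedge⇒≁ ik ∘ ~-sym) (nonedge⇒≁ jk ∘ ~-sym)
                (⁻⇒≁ xi) (⁻⇒≁ xj) (nonedge⇒≁ il ∘ ~-sym) (nonedge⇒≁ jl ∘ ~-sym) })
            ∷ [])))
      (All-eachPath K λ {i} {j} {k} i≢k ij jk ik → All-each λ l →
        All-when (far? K i j l ×-dec nonedge? K k l) λ ((il , jl) , kl) →
          (λ { out (xl ∷ xi ∷ xj ∷ xk ∷ []) →
            ¬P₃∪P₂ (i≢k ∘ injective real) (edge⇒~ ij) (edge⇒~ jk) (nonedge⇒≁ ik)
              (⁺⇒~ xl) (⁻⇒≁ xi ∘ ~-sym) (nonedge⇒≁ il) (⁻⇒≁ xj ∘ ~-sym) (nonedge⇒≁ jl)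
              (⁻⇒≁ xk ∘ ~-sym) (nonedge⇒≁ kl) })
          ∷ [])

  Excludes : ∀ {n} → (Fin n → Fin N) → Cube n × Cube n → Set
  Excludes f (c , d) = ∀ {x y} → Outside f x → Outside f y → x ~ y →
    Matches (row f x) c → ¬ Matches (row f y) d

  pairCubes-sound : ∀ {n} {K : Shape n} {f} → Realises K f → All (Excludes f) (pairCubes K)
  pairCubes-sound {K = K} {f} real = All.++⁺
    (All-eachEdge K λ {i} {j} ij →
      (λ { _ _ xy (xi ∷ xj ∷ []) (yi ∷ yj ∷ []) →
        ¬K₄ xy (⁺⇒~ real xi) (⁺⇒~ real xj) (⁺⇒~ real yi) (⁺⇒~ real yj) (edge⇒~ real ij) })
      ∷ All-each λ k → All-when (far? K i j k) λ (ik , jk) →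
          (λ { _ outy xy (xk ∷ xi ∷ xj ∷ []) (yk ∷ yi ∷ yj ∷ []) →
            path ij ik jk outy xy xk xi xj yk yi yj })
        ∷ (λ { outx _ xy (xk ∷ xi ∷ xj ∷ []) (yk ∷ yi ∷ yj ∷ []) →
            path ij ik jk outx (~-sym xy) yk yi yj xk xi xj })
        ∷ [])
    (All-eachPath K λ i≢k ij jk ik →
      (λ { _ _ xy (xi ∷ xj ∷ xk ∷ []) (yi ∷ yj ∷ yk ∷ []) →
        ¬P₃∪P₂ (i≢k ∘ injective real) (edge⇒~ real ij) (edge⇒~ real jk) (nonedge⇒≁ real ik) xy
          (⁻⇒≁ real xi ∘ ~-sym) (⁻⇒≁ real yi ∘ ~-sym) (⁻⇒≁ real xj ∘ ~-sym)
          (⁻⇒≁ real yj ∘ ~-sym) (⁻⇒≁ real xk ∘ ~-sym) (⁻⇒≁ real yk ∘ ~-sym) })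
      ∷ [])
    where
    -- The path is `k x y`, apart from the edge `i j`. Exchanging `x` and `y` serves the mirrored
    -- pair of cubes.
    path : ∀ {i j k x y} → Edge K i j → Nonedge K i k → Nonedge K j k → Outside f y → x ~ y →
      row f x ⊨ (k ⁺) → row f x ⊨ (i ⁻) → row f x ⊨ (j ⁻) →
      row f y ⊨ (k ⁻) → row f y ⊨ (i ⁻) → ¬ row f y ⊨ (j ⁻)
    path {k = k} ij ik jk outy xy xk xi xj yk yi yj =
      ¬P₃∪P₂ (outy k) (~-sym (⁺⇒~ real xk)) xy (⁻⇒≁ real yk ∘ ~-sym) (edge⇒~ real ij)
        (nonedge⇒≁ real ik ∘ ~-sym) (nonedge⇒≁ real jk ∘ ~-sym)
        (⁻⇒≁ real xi) (⁻⇒≁ real xj) (⁻⇒≁ real yi) (⁻⇒≁ real yj)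

  -- The invariant of a run through a certificate: every row and every edge of `G` outside the image
  -- of `f` is one that `Θ` still allows.
  record Sound {n} (Θ : Theory n) (f : Fin n → Fin N) : Set where
    constructor sound
    field
      realises : Realises (table Θ) f
      complete : ∀ {x} → Outside f x → row f x ∈ rows Θ
      excludes : All (Excludes f) (blocks Θ)

  open Sound

  blocked⇒≁ : ∀ {n} {Θ : Theory n} {f x y} → Sound Θ f → Outside f x → Outside f y →
    Blocks (blocks Θ) (row f x) (row f y) → ¬ x ~ y
  blocked⇒≁ S outx outy b xy with e , m , m′ ← All.lookupAny (excludes S) b =
    e outx outy xy m m′

  start-sound : ∀ {n} {K : Shape n} {f} → Realises K f → Sound (start K) f
  start-sound {K = K} {f} real = sound real
    (λ {x} out → ∈-filter⁺ (avoids? (vertexCubes K)) (∈-allRows (row f x)) λ m →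
      let e , m′ = All.lookupAny (vertexCubes-sound real) m in e out m′)
    (pairCubes-sound real)

  extend-sound : ∀ {n} {Θ : Theory n} {f x r} → Sound Θ f → Outside f x → row f x ≡ r →
    Sound (extend Θ r) (x ◂ f)
  extend-sound {Θ = theory K rs bs} {f} {x} {r} S outx refl =
    sound real (λ {y} → complete′ y) (All.++⁺ (All.map⁺ (All.map old (excludes S))) new)
    where
    real : Realises (r ▷ K) (x ◂ f)
    real = adjoin (realises S) outx refl

    children : Row _ → List (Row _)
    children s = (false ∷ s) ∷ when (¬? (blocks? bs r s)) ((true ∷ s) ∷ [])

    child : ∀ y → Outside f y → row (x ◂ f) y ∈ children (row f y)
    child y outy with y ~? x
    ... | no _   = here refl
    -- Blocked rows would contradict `x ~ y`, so `extend` has kept the child with bit `true`.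
    ... | yes yx = there (∈-when (¬? (blocks? bs r (row f y)))
                     (λ b → blocked⇒≁ S outx outy b (~-sym yx)) (here refl))

    complete′ : ∀ y → Outside (x ◂ f) y → row (x ◂ f) y ∈ rows (extend (theory K rs bs) r)
    complete′ y out = ∈-filter⁺ (avoids? (filter new? (vertexCubes (r ▷ K))))
      (∈-concatMap⁺ children (lose (complete S (out ∘ suc)) (child y (out ∘ suc)))) λ m →
      let e , m′ = All.lookupAny (All.filter⁺ new? (vertexCubes-sound real)) m in e out m′

    old : ∀ {(c , d) : Cube _ × Cube _} → Excludes f (c , d) →
      Excludes (x ◂ f) (weaken c , weaken d)
    old ex outy outz yz m m′ = ex (outy ∘ suc) (outz ∘ suc) yz (All.map⁻ m) (All.map⁻ m′)

    new : All (Excludes (x ◂ f)) (filter (λ (c , d) → new? c ⊎-dec new? d) (pairCubes (r ▷ K)))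
    new = All.filter⁺ _ (pairCubes-sound real)

  -- From a coloured theory to a 7-colouring of the graph.

  module _ {n} {Θ : Theory n} {f : Fin n → Fin N} (S : Sound Θ f)
    {cs : Vec (Fin 7) n} {es : List (Entry n)} (proper : Proper Θ cs es)
    (covers : ∀ {r} → r ∈ rows Θ → ∃ λ p → (r , p) ∈ es) where

    inside? : ∀ x → Dec (∃ λ i → f i ≡ x)
    inside? x = any? λ i → f i ≟ x

    -- In a matching, the later end of each edge takes the second colour.
    Later : Fin N → Set
    Later x = ∃ λ y → y < x × row f y ≡ row f x × y ~ x

    later? : ∀ x → Dec (Later x)
    later? x = any? λ y → y <? x ×-dec row f y ≟ʳ row f x ×-dec y ~? x

    pick : {A : Set} → Dec A → Fin 7 × Fin 7 → Fin 7
    pick d (a , b) = if does d then b else a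

    pick-elim : ∀ {A : Set} (d : Dec A) (P : Fin 7 → Set) {p} →
      P (proj₁ p) × P (proj₂ p) → P (pick d p)
    pick-elim (yes _) P = proj₂
    pick-elim (no _)  P = proj₁

    entry : ∀ {x} → ¬ (∃ λ i → f i ≡ x) → ∃ λ p → (row f x , p) ∈ es
    entry out = covers (complete S λ i e → out (i , e))

    -- The decision is an argument so that `colour-proper` can split on it at both ends of an edge.
    colour : ∀ x → Dec (∃ λ i → f i ≡ x) → Fin 7
    colour x (yes (i , _)) = lookup cs i
    colour x (no out)      = pick (later? x) (proj₁ (entry out))

    -- If z < x < y all have row r and z ~ x ~ y, then z x y is a path or a
    -- triangle, which the definition of Matching rules out.
    first-not-later : ∀ {x y} → Matching (table Θ) (row f x) →
      x < y → row f x ≡ row f y → x ~ y → ¬ Later x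
    first-not-later {x} {y} ((i , xi) , j , k , jk , xj , xk) x<y xy x~y (z , z<x , zx , z~x)
      with z ~? y
    ... | yes z~y = ¬K₄ z~x z~y (adj zx xi) x~y (adj refl xi) (adj (sym xy) xi)
      where
      adj : ∀ {w} → row f w ≡ row f x → row f x ⊨ (i ⁺) → w ~ f i
      adj e xi = ⁺⇒~ (realises S) (subst (_⊨ (i ⁺)) (sym e) xi)
    ... | no z≁y = ¬P₃∪P₂ (<⇒≢ (<-trans z<x x<y)) z~x x~y z≁y (edge⇒~ (realises S) jk)
        (non zx xj) (non zx xk) (non refl xj) (non refl xk) (non (sym xy) xj) (non (sym xy) xk)
      where
      non : ∀ {w l} → row f w ≡ row f x → row f x ⊨ (l ⁻) → ¬ w ~ f l
      non {l = l} e xl = ⁻⇒≁ (realises S) (subst (_⊨ (l ⁻)) (sym e) xl)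

    matched : ∀ {x y} {p : Fin 7 × Fin 7} → Matching (table Θ) (row f x) → x < y →
      row f x ≡ row f y → x ~ y → proj₁ p ≢ proj₂ p →
      pick (later? x) p ≢ pick (later? y) p
    matched {x} {y} m x<y xy x~y a≢b
      -- `x` takes the first colour, and `y` the second, with `x` itself witnessing `Later y`.
      rewrite dec-false (later? x) (first-not-later m x<y xy x~y)
            | dec-true (later? y) (x , x<y , xy , x~y) = a≢b

    compatible⇒≢ : ∀ {x y p q} → Outside f x → Outside f y → x ~ y →
      Compatible Θ (row f x , p) (row f y , q) → pick (later? x) p ≢ pick (later? y) q
    compatible⇒≢ {x} {y} {p} {q} _ _ _ (inj₁ ((aa′ , ab′) , (ba′ , bb′))) =
      pick-elim (later? x) (λ u → u ≢ pick (later? y) q)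
        ( pick-elim (later? y) (λ v → proj₁ p ≢ v) (aa′ , ab′)
        , pick-elim (later? y) (λ v → proj₂ p ≢ v) (ba′ , bb′))
    compatible⇒≢ outx outy x~y (inj₂ (inj₁ b)) = contradiction x~y (blocked⇒≁ S outx outy b)
    -- In a matching, the order of `x` and `y` tells which end is `Later`.
    compatible⇒≢ {x} {y} _ _ x~y (inj₂ (inj₂ (xy , refl , refl , a≢b , m))) with <-cmp x y
    ... | tri< x<y _ _ = matched m x<y xy x~y a≢b
    ... | tri≈ _ x≡y _ = contradiction x~y (~-irr x≡y)
    ... | tri> _ _ y<x = matched (subst (Matching (table Θ)) xy m) y<x (sym xy) (~-sym x~y) a≢b ∘ sym

    inside-outside : ∀ {i y} (out : ¬ (∃ λ j → f j ≡ y)) → f i ~ y →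
      lookup cs i ≢ pick (later? y) (proj₁ (entry out))
    inside-outside {i} {y} out e = pick-elim (later? y) (lookup cs i ≢_)
      (All.lookup (proj₁ (proj₂ proper)) (proj₂ (entry out)) i
        (trans (Vec.lookup∘tabulate _ i) (dec-true (y ~? f i) (~-sym e))))

    colour-proper : ∀ {x y} d d′ → x ~ y → colour x d ≢ colour y d′
    colour-proper (yes (i , refl)) (yes (j , refl)) e =
      proj₁ proper i j (trans (sym (adjacency (realises S) i j)) (dec-true (f i ~? f j) e))
    colour-proper (yes (i , refl)) (no out) e = inside-outside out e
    colour-proper (no out) (yes (i , refl)) e = inside-outside out (~-sym e) ∘ sym
    colour-proper (no out) (no out′) e =
      compatible⇒≢ (λ i e → out (i , e)) (λ i e → out′ (i , e)) e
        (All.lookup (All.lookup (proj₂ (proj₂ proper)) (proj₂ (entry out))) (proj₂ (entry out′)))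

    colourable : Colourable G 7
    colourable = (λ x → colour x (inside? x)) , λ x y → colour-proper (inside? x) (inside? y)

  coloured⇒colourable : ∀ {n} {Θ : Theory n} {f d} → Sound Θ f → Coloured Θ d → Colourable G 7
  coloured⇒colourable {n} {Θ} {d = d} S proper =
    colourable S {cs = digits n d} proper (entries-complete (blocks Θ) (fold d (_/ 7) n))

  without-sound : ∀ {n} {Θ : Theory n} {f r} → Sound Θ f →
    (∀ {x} → Outside f x → row f x ≢ r) → Sound (without Θ r) f
  without-sound {r = r} (sound real compl ex) no-r = sound real
    (λ out → ∈-filter⁺ (λ s → ¬? (s ≟ʳ r)) (compl out) (no-r out)) ex

  separate-sound : ∀ {n} {Θ : Theory n} {f r s} → Sound Θ f →
    (∀ {x y} → Outside f x → Outside f y → row f x ≡ r → row f y ≡ s → ¬ x ~ y) →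
    Sound (separate Θ r s) f
  separate-sound (sound real compl ex) no-rs = sound real compl
    ( (λ outx outy x~y m m′ → no-rs outx outy (exactly⇒≡ m) (exactly⇒≡ m′) x~y)
    ∷ (λ outx outy x~y m m′ → no-rs outy outx (exactly⇒≡ m′) (exactly⇒≡ m) (~-sym x~y))
    ∷ ex)

  -- Under the refutation `nc`, a vertex of row `r`, or an edge between rows `r` and `s`, is
  -- impossible, since the checked extension would colour `G`. Hence the refined theory is sound and
  -- the induction goes on.
  certifies⇒colourable : ∀ {n} {Θ : Theory n} {f} ss {d} → Sound Θ f → Certifies Θ ss d →
    ¬ ¬ Colourable G 7
  certifies⇒colourable [] S c nc = nc (coloured⇒colourable S c)
  certifies⇒colourable (drop r e ∷ ss) S (c , cs) nc =
    certifies⇒colourable ss (without-sound S λ out eq →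
      nc (coloured⇒colourable (extend-sound S out eq) c)) cs nc
  certifies⇒colourable (cut r s e ∷ ss) S (c , cs) nc =
    certifies⇒colourable ss (separate-sound S λ {x} {y} outx outy eqx eqy x~y →
      nc (coloured⇒colourable
        (extend-sound (extend-sound S outx eqx)
          -- The second vertex must also differ from the first, which their adjacency ensures.
          (λ { zero → ~⇒≢ x~y ; (suc i) → outy i })
          (cong₂ _∷_ (dec-true (y ~? x) (~-sym x~y)) eqy)) c)) cs nc

  -- `Colourable G 7` is decidable, which removes the double negation; minimality of `χ G` gives the
  -- bound.
  χ≤7 : ∀ {n} {H : Graph n} → Certificate H → G Contains H → χ G ≤ 7
  χ≤7 {H = H} cert H⊆G = proj₂ (proj₂ (chromatic G)) 7 (decidable-stable (colourable? G 7)
    (certifies⇒colourable steps (start-sound (contains⇒realises {H = H} H⊆G))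
      (toWitness valid)))
    where open Certificate cert

-- The certificates for the co-A and the co-domino.

among : ∀ {n} → List (Fin n) → Row n
among is = tabulate λ i → does (i ∈? is)
  where open DecMembership _≟_ using (_∈?_)

-- Each numeral colours the extension made by its step and is checked against the theory left by the
-- preceding steps; `final` colours what remains.
co-A-certificate : Certificate co-A
co-A-certificate = record
  { steps =
      drop (among (u₁ ∷ v₁ ∷ v₂ ∷ [])) 2241967209438074706007388225208
    ∷ drop (among (v₁ ∷ v₂ ∷ [])) 25809986353231685192672
    ∷ drop (among (v₃ ∷ u₃ ∷ u₂ ∷ [])) 1288477021782892265879753255
    ∷ cut (among (u₁ ∷ v₃ ∷ [])) (among (v₂ ∷ v₃ ∷ u₃ ∷ []))
        476982267329284430073373788735142477301686
    ∷ cut (among (u₁ ∷ v₃ ∷ [])) (among (u₁ ∷ v₁ ∷ u₂ ∷ []))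
        36667714103437871852492777786416874297150
    ∷ cut (among (v₁ ∷ u₂ ∷ [])) (among (v₂ ∷ u₃ ∷ u₂ ∷ []))
        52515851599853991820689920
    ∷ cut (among (v₁ ∷ u₂ ∷ [])) (among (v₁ ∷ v₂ ∷ u₃ ∷ u₂ ∷ []))
        106908122215047911576347985142048
    ∷ drop (among (v₁ ∷ v₂ ∷ u₂ ∷ [])) 36471072483141674242838285062976196
    ∷ cut (among (u₁ ∷ v₁ ∷ v₂ ∷ u₂ ∷ [])) (among (v₁ ∷ u₃ ∷ u₂ ∷ []))
        4952889803001216642935779733378181344709
    ∷ drop (among (u₁ ∷ v₁ ∷ u₃ ∷ [])) 10452304331299526600192984907077858145
    ∷ drop (among (v₁ ∷ u₃ ∷ u₂ ∷ [])) 183998633226898473209583435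
    ∷ drop (among (v₂ ∷ u₃ ∷ u₂ ∷ [])) 195675356205748355789679470684
    ∷ cut (among (v₂ ∷ u₃ ∷ [])) (among (v₁ ∷ u₂ ∷ []))
        1449901016441995070812374640992
    ∷ cut (among (u₁ ∷ v₃ ∷ [])) (among (v₁ ∷ u₃ ∷ []))
        5274574838507324739061071324364725929708156772874
    ∷ []
  ; final = 1933360717174662769619760
  -- Evaluating `certifies?` reduces `True` to the unit type, whose element is inferred.
  ; valid = _
  }

co-domino-certificate : Certificate co-domino
co-domino-certificate = record
  { steps =
      drop (among (u₁ ∷ v₁ ∷ u₂ ∷ [])) 15486129580213846174284805
    ∷ drop (among (v₃ ∷ u₃ ∷ u₂ ∷ [])) 537321504992166348955929
    ∷ drop (among (v₂ ∷ v₃ ∷ u₃ ∷ [])) 240710980407906685803387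
    ∷ cut (among (v₁ ∷ u₃ ∷ [])) (among (v₂ ∷ u₃ ∷ u₂ ∷ []))
        89521294163283129388271075998766749169
    ∷ cut (among (u₁ ∷ v₃ ∷ [])) (among (u₁ ∷ v₂ ∷ u₂ ∷ []))
        71352714648994958022611155302211588217
    ∷ cut (among []) (among (u₁ ∷ v₁ ∷ v₃ ∷ u₃ ∷ []))
        101787826146935404714688543489539781934
    ∷ cut (among (v₁ ∷ v₃ ∷ u₂ ∷ [])) (among (v₂ ∷ v₃ ∷ u₃ ∷ u₂ ∷ []))
        211356220346040082011214034301332388414905765
    ∷ drop (among (u₁ ∷ v₁ ∷ v₂ ∷ u₃ ∷ [])) 86680178712744751119284822455
    ∷ drop (among (u₁ ∷ v₁ ∷ v₂ ∷ u₂ ∷ [])) 12217419357608933482858453044038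
    ∷ cut (among (u₁ ∷ v₂ ∷ u₃ ∷ [])) (among (v₂ ∷ v₃ ∷ u₂ ∷ []))
        186806047588226545331463480648
    ∷ drop (among (u₁ ∷ v₂ ∷ v₃ ∷ u₃ ∷ [])) 385030467912755224199362767
    ∷ cut (among (v₁ ∷ u₃ ∷ [])) (among (v₁ ∷ v₂ ∷ u₂ ∷ []))
        2099280885027353921690600775282
    ∷ cut (among (u₁ ∷ v₂ ∷ v₃ ∷ u₂ ∷ [])) (among (v₁ ∷ v₂ ∷ u₃ ∷ u₂ ∷ []))
        12455038099466877866429801375901038206982156
    ∷ drop (among (u₁ ∷ v₂ ∷ u₃ ∷ [])) 13551736756018036511713344404
    ∷ []
  ; final = 131554360390218666798
  ; valid = _
  }

theorem1p2 : ∀ {n : ℕ} (G : Graph n) →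
    G IsFreeOf (Path 3 ∪ Path 2) →
    G IsFreeOf Complete 4 →
    (G Contains co-domino) ⊎ (G Contains co-A) →
    χ G ≤ 7
theorem1p2 G noP₃∪P₂ noK₄ (inj₁ c) =
  Colouring.χ≤7 G noP₃∪P₂ noK₄ co-domino-certificate c
theorem1p2 G noP₃∪P₂ noK₄ (inj₂ c) =
  Colouring.χ≤7 G noP₃∪P₂ noK₄ co-A-certificate c
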